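{- Let $\lambda>\aleph_0$ be a regular cardinal and let $D$ be a doubly$^+$ regular filter on $\lambda$. Then the principle $\square^{\mathrm{fin}}_{\lambda,D}$ holds.
   Context: A family of sets is a regular family if finite intersections of members of the family are non-empty but all infinite intersections (i.e. intersections of infinitely many members) are empty. A filter is $\mu$-regular if it contains a regular family of size $\mu$. A filter on $\lambda$, or on a set of cardinality $\lambda$, is called regular if it is $\lambda$-regular. A filter $D$ on a regular cardinal $\lambda$ is called doubly$^+$ regular if there are pairwise disjoint sets $u_i\subseteq\lambda$, $i<\lambda$, each of cardinality $\lambda$, and regular filters $D_i$ on $u_i$, such that for all $A\subseteq\lambda$: if there is a club $C\subseteq\lambda$ with $A\cap u_i\in D_i$ for all $i\in C$, then $A\in D$. The principle $\square^{\mathrm{fin}}_{\lambda,D}$ states: $D$ is a filter on the cardinal $\lambda$ and there exist finite sets $C_\alpha^\xi$ and integers $n_\xi$, for each $\alpha<\lambda^+$ and $\xi<\lambda$, such that for all $\xi<\lambda$ and $\alpha<\lambda^+$: (i) $C_\alpha^\xi\subseteq\alpha+1$; (ii) if $B\subset\lambda^+$ is a finite set of ordinals and $\alpha<\lambda^+$ is such that $B\subseteq\alpha+1$, then $\{\xi<\lambda: B\subseteq C_\alpha^\xi\}\in D$; (iii) $\beta\in C_\alpha^\xi$ implies $C_\beta^\xi=C_\alpha^\xi\cap(\beta+1)$; (iv) $|C_\alpha^\xi|<n_\xi$. -}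

module Defs where

open import Axiom.ExcludedMiddle using (ExcludedMiddle)
open import Data.List.Base using (List; length)
open import Data.List.Membership.Propositional using () renaming (_∈_ to _∈ˡ_)
open import Data.List.Relation.Unary.All using (All)
open import Data.List.Relation.Unary.Enumerates.Setoid using (IsEnumeration)
open import Data.List.Relation.Unary.Unique.Propositional using (Unique)
open import Data.Nat.Base as ℕ using (ℕ)
open import Data.Product.Base using (Σ; ∃; _×_; proj₁)
open import Function.Bundles using (Injection; Bijection)
open import Level using (Level; _⊔_; suc; Setω)
open import Relation.Binary.Bundles using (Setoid)
open import Relation.Binary.Core using (Rel)
import Relation.Binary.Construct.On as On
import Relation.Binary.Construct.StrictToNonStrict as ToNonStrict
open import Relation.Binary.PropositionalEquality using (_≡_; _≢_; setoid)
open import Relation.Binary.Structures using (IsStrictTotalOrder)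
open import Induction.WellFounded using (WellFounded)
open import Relation.Nullary.Negation using (¬_)
open import Relation.Unary using (Pred; _∈_; _⊆_; _∩_; _⊥_; _≐_)
open import Relation.Unary.Polymorphic using (U)
open import Relation.Unary.Relation.Binary.Equality using (≐-setoid)

private
  variable
    a b ℓ p d : Level

-- The ambient theory is ZFC.  Since `ExcludedMiddle` decides every type, not
-- only the propositions, it yields the axiom of choice as well as classical
-- logic.
Classical : Setω
Classical = ∀ {a} → ExcludedMiddle a

------------------------------------------------------------------------
-- Cardinality

-- A subset as a setoid.  Equality ignores the membership proofs, so that
-- proof-relevant predicates still have the cardinality of the subset.
⟪_⟫ : {S : Setoid a b} → Pred (Setoid.Carrier S) p → Setoid (a ⊔ p) b
⟪_⟫ {S = S} P = On.setoid S (proj₁ {B = P})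

-- Members of a family of sets are identified when extensionally equal.
⟪_⟫ᶠ : {X : Set a} → Pred (Pred X ℓ) p → Setoid (a ⊔ suc ℓ ⊔ p) (a ⊔ ℓ)
⟪_⟫ᶠ {ℓ = ℓ} {X = X} F = ⟪_⟫ {S = ≐-setoid X ℓ} F

⟪_⟫ˢ : {X : Set a} → Pred X p → Setoid (a ⊔ p) a
⟪_⟫ˢ {X = X} P = ⟪_⟫ {S = setoid X} P

Finite : Setoid a b → Set (a ⊔ b)
Finite S = ∃ (IsEnumeration S)

Infinite : Setoid a b → Set (a ⊔ b)
Infinite S = ¬ Finite S

-- Duplicate-free lists, so that the length is the cardinality.
FinSet : Set a → Set a
FinSet A = Σ (List A) Unique

⌊_⌋ : {A : Set a} → FinSet A → Pred A a
⌊ B ⌋ x = x ∈ˡ proj₁ B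

card : {A : Set a} → FinSet A → ℕ
card B = length (proj₁ B)

-- A cardinal is an initial ordinal: a well-ordered type that does not inject
-- into any of its proper initial segments.
record Cardinal ℓ : Set (suc ℓ) where
  infix 4 _<_
  field
    Carrier            : Set ℓ
    _<_                : Rel Carrier ℓ
    isStrictTotalOrder : IsStrictTotalOrder _≡_ _<_
    wellFounded        : WellFounded _<_
    initial            : ∀ α → ¬ Injection (setoid Carrier) ⟪ _< α ⟫ˢ

  open ToNonStrict _≡_ _<_ public using (_≤_)

  -- The ordinal α, and the ordinal α + 1, as sets of smaller ordinals.
  ↓_ ↓₁_ : Carrier → Pred Carrier ℓ
  ↓ α  = _< α
  ↓₁ α = _≤ α

∣_∣ : Cardinal ℓ → Setoid ℓ ℓ
∣ Λ ∣ = setoid (Cardinal.Carrier Λ)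

Uncountable : Cardinal ℓ → Set ℓ
Uncountable Λ = Injection (setoid ℕ) ∣ Λ ∣ × ¬ Injection ∣ Λ ∣ (setoid ℕ)

-- Λ⁺ is the least ordinal whose cardinality exceeds that of Λ.
record IsSuccessorOf (Λ Λ⁺ : Cardinal ℓ) : Set ℓ where
  open Cardinal Λ⁺ using (↓_)
  field
    above  : Injection ∣ Λ ∣ ∣ Λ⁺ ∣
    strict : ¬ Injection ∣ Λ⁺ ∣ ∣ Λ ∣
    least  : ∀ α → Injection ⟪ ↓ α ⟫ˢ ∣ Λ ∣

------------------------------------------------------------------------
-- Filters

-- A proper filter on the subset u of X; its members are subsets of u.
record IsFilterOn {X : Set ℓ} (u : Pred X ℓ) (D : Pred (Pred X ℓ) d) :
                  Set (suc ℓ ⊔ d) where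
  field
    subsets  : ∀ {A} → A ∈ D → A ⊆ u
    whole    : u ∈ D
    upward   : ∀ {A B} → A ∈ D → A ⊆ B → B ⊆ u → B ∈ D
    meet     : ∀ {A B} → A ∈ D → B ∈ D → (A ∩ B) ∈ D
    nonempty : ∀ {A} → A ∈ D → ∃ A

record IsRegularFamily {X : Set ℓ} (F : Pred (Pred X ℓ) ℓ) : Set (suc ℓ) where
  field
    finite   : ∀ As → All (_∈ F) As → ∃ λ x → All (x ∈_) As
    infinite : ∀ (T : Pred (Pred X ℓ) ℓ) → T ⊆ F → Infinite ⟪ T ⟫ᶠ →
               ¬ ∃ λ x → ∀ A → A ∈ T → x ∈ A

-- The family may be taken at level ℓ: one of size μ is, up to extensional
-- equality of its members, the range of a function defined on μ.
IsRegularFilter : {X : Set ℓ} → Cardinal ℓ → Pred (Pred X ℓ) d → Set (suc ℓ ⊔ d)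
IsRegularFilter {ℓ = ℓ} {X = X} μ D =
  Σ (Pred (Pred X ℓ) ℓ) λ F → F ⊆ D × IsRegularFamily F × Bijection ⟪ F ⟫ᶠ ∣ μ ∣

------------------------------------------------------------------------
-- Regular cardinals, clubs and doubly⁺ regular filters

module _ (Λ : Cardinal ℓ) where
  open Cardinal Λ

  Unbounded : Pred Carrier ℓ → Set ℓ
  Unbounded P = ∀ β → ∃ λ γ → γ ∈ P × β ≤ γ

  -- An infinite cardinal equal to its own cofinality.
  IsRegularCardinal : Set (suc ℓ)
  IsRegularCardinal = Infinite ∣ Λ ∣ ×
    (∀ (P : Pred Carrier ℓ) → Unbounded P → Injection ∣ Λ ∣ ⟪ P ⟫ˢ)

  IsLimit : Carrier → Set ℓ
  IsLimit δ = ∃ (↓ δ) × (∀ β → β < δ → ∃ λ γ → β < γ × γ < δ)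

  record IsClub (C : Pred Carrier ℓ) : Set ℓ where
    field
      unbounded : Unbounded C
      closed    : ∀ δ → IsLimit δ →
                  (∀ β → β < δ → ∃ λ γ → γ ∈ C × β ≤ γ × γ < δ) → δ ∈ C

  record IsDoubly⁺Regular (D : Pred (Pred Carrier ℓ) d) : Set (suc (ℓ ⊔ d)) where
    field
      isFilter : IsFilterOn U D
      u        : Carrier → Pred Carrier ℓ
      disjoint : ∀ i j → i ≢ j → u i ⊥ u j
      size     : ∀ i → Bijection ⟪ u i ⟫ˢ ∣ Λ ∣
      Dᵢ       : Carrier → Pred (Pred Carrier ℓ) d
      filterᵢ  : ∀ i → IsFilterOn (u i) (Dᵢ i)
      regularᵢ : ∀ i → IsRegularFilter Λ (Dᵢ i)
      clubs    : ∀ A → (Σ (Pred Carrier ℓ) λ C → IsClub C ×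
                        (∀ i → i ∈ C → (A ∩ u i) ∈ Dᵢ i)) → A ∈ D

------------------------------------------------------------------------
-- The finite square principle

-- Here Λ⁺ is meant to be the successor of Λ.
record □ᶠⁱⁿ (Λ Λ⁺ : Cardinal ℓ)
            (D : Pred (Pred (Cardinal.Carrier Λ) ℓ) d) : Set (suc ℓ ⊔ d) where
  open Cardinal Λ using () renaming (Carrier to |Λ|)
  open Cardinal Λ⁺ using (↓₁_) renaming (Carrier to |Λ⁺|)
  field
    isFilter : IsFilterOn U D
    C        : |Λ⁺| → |Λ| → FinSet |Λ⁺|
    n        : |Λ| → ℕ
    bounded  : ∀ ξ α → ⌊ C α ξ ⌋ ⊆ ↓₁ α
    large    : ∀ (B : FinSet |Λ⁺|) α → ⌊ B ⌋ ⊆ ↓₁ α →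
               (λ ξ → ⌊ B ⌋ ⊆ ⌊ C α ξ ⌋) ∈ D
    coherent : ∀ ξ α β → β ∈ ⌊ C α ξ ⌋ → ⌊ C β ξ ⌋ ≐ ⌊ C α ξ ⌋ ∩ ↓₁ β
    small    : ∀ ξ α → card (C α ξ) ℕ.< n ξ

{-# OPTIONS --safe #-}

-- Fix injections e_α : α → λ.  For i < λ let β ⊏[ i ] α mean that β belongs to
-- A_{α,i} = {γ < α : e_α(γ) < i} and that A_{β,i} = A_{α,i} ∩ β.  Each ⊏[ i ]
-- is a tree order in which every α has fewer than λ predecessors, so there is
-- a function level i : λ⁺ → λ that is injective on its chains; and for β < α
-- the set of i with β ⊏[ i ] α is a club.  A point ξ of u_i lies in only
-- finitely many members X_δ of a regular family of Dᵢ, and C_α^ξ consists of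
-- the β ⊑[ i ] α whose level is one of these δ.  If β ⊑[ i ] α, then
-- β ∈ C_α^ξ for every ξ in X_δ, where δ is the level of β.

module Submission where

open import Defs
open import Data.List.Base using (List; []; _∷_; length; map)
open import Data.List.Membership.Propositional using () renaming (_∈_ to _∈ˡ_)
import Data.List.Relation.Unary.All as All
open import Data.List.Relation.Unary.AllPairs using ([]; _∷_)
open import Data.List.Relation.Unary.Any using (Any; here; there)
open import Data.Nat.Base as ℕ using (ℕ)
import Data.Nat.Properties as ℕ
open import Data.Product.Base using (Σ; ∃; _×_; _,_; proj₁; proj₂)
open import Data.Sum.Base using (_⊎_; inj₁; inj₂)
open import Function.Base using (_∘_)
open import Function.Bundles using (Injection; Bijection)
import Induction.WellFounded as WF
open import Level using (Level; _⊔_)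
open import Relation.Binary.Bundles using (Setoid)
open import Relation.Binary.Definitions using (tri<; tri≈; tri>)
open import Relation.Binary.PropositionalEquality
  using (_≡_; _≢_; refl; sym; trans; cong; subst; setoid)
open import Relation.Binary.Structures using (IsStrictTotalOrder)
open import Relation.Nullary.Decidable
  using (Dec; yes; no; decidable-stable; recompute)
open import Relation.Nullary.Negation using (¬_; contradiction)
open import Relation.Unary using (Pred; _∈_; _∉_; _⊆_; _∩_; _≐_)

private
  variable
    a b ℓ p q d : Level

-- Finite preimages under excluded middle.

module ClassicalLogic (em : Classical) where

  dne : {P : Set p} → ¬ ¬ P → P
  dne = decidable-stable em

  ¬∀⇒∃¬ : {A : Set a} {P : Pred A p} → ¬ (∀ x → P x) → ∃ λ x → ¬ P x
  ¬∀⇒∃¬ ¬∀ = dne λ ¬∃ → ¬∀ λ x → dne λ ¬Px → ¬∃ (x , ¬Px)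

  InjectiveOn : {A : Set a} {B : Set b} → Pred A p → (A → B) → Set (a ⊔ b ⊔ p)
  InjectiveOn P f = ∀ {x y} → x ∈ P → y ∈ P → f x ≡ f y → x ≡ y

  -- By injectivity each entry of `ys` adds at most one point. The test `x ∉ ⌊ F ⌋` keeps the list
  -- duplicate-free when `ys` repeats a value. The bound depends on `ys` alone, which later makes it
  -- uniform in `α`.
  finitePreimage : {A : Set a} {B : Set b} (P : Pred A p) (f : A → B) →
    InjectiveOn P f → (ys : List B) →
    Σ (FinSet A) λ F →
      (⌊ F ⌋ ≐ λ x → x ∈ P × f x ∈ˡ ys) × card F ℕ.≤ length ys
  finitePreimage P f inj [] = ([] , []) , ((λ ()) , λ { (_ , ()) }) , ℕ.z≤n
  finitePreimage P f inj (y ∷ ys)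
    with finitePreimage P f inj ys
  ... | F@(xs , unique) , (F⊆ , ⊆F) , F≤
    with em {P = ∃ λ x → x ∈ P × f x ≡ y × x ∉ ⌊ F ⌋}
  ... | yes (x , Px , fx≡y , x∉F) =
      (x ∷ xs , All.tabulate (λ z∈xs x≡z → x∉F (subst ⌊ F ⌋ (sym x≡z) z∈xs)) ∷ unique)
    , ( (λ { (here refl) → Px , here fx≡y
           ; (there z∈F) → let Pz , fz∈ys = F⊆ z∈F in Pz , there fz∈ys })
      , (λ { (Pz , here fz≡y)   → here (inj Pz Px (trans fz≡y (sym fx≡y)))
           ; (Pz , there fz∈ys) → there (⊆F (Pz , fz∈ys)) }))
    , ℕ.s≤s F≤
  ... | no none =
      F
    , ( (λ z∈F → let Pz , fz∈ys = F⊆ z∈F in Pz , there fz∈ys)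
      , (λ { (Pz , here fz≡y)   → dne λ z∉F → none (_ , Pz , fz≡y , z∉F)
           ; (Pz , there fz∈ys) → ⊆F (Pz , fz∈ys) }))
    , ℕ.m≤n⇒m≤1+n F≤

-- Order and least elements in a cardinal.

module CardinalProperties (em : Classical) {ℓ} (Λ : Cardinal ℓ) where
  open ClassicalLogic em
  open Cardinal Λ
  open IsStrictTotalOrder isStrictTotalOrder public
    using (compare; irrefl; asym) renaming (trans to <-trans)

  ≮⇒≥ : ∀ {x y} → ¬ x < y → y ≤ x
  ≮⇒≥ {x} {y} x≮y with compare x y
  ... | tri< x<y _ _ = contradiction x<y x≮y
  ... | tri≈ _ x≡y _ = inj₂ (sym x≡y)
  ... | tri> _ _ y<x = inj₁ y<x

  ≰⇒> : ∀ {x y} → ¬ x ≤ y → y < x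
  ≰⇒> {x} {y} x≰y with compare x y
  ... | tri< x<y _ _ = contradiction (inj₁ x<y) x≰y
  ... | tri≈ _ x≡y _ = contradiction (inj₂ x≡y) x≰y
  ... | tri> _ _ y<x = y<x

  ≤-<-trans : ∀ {x y z} → x ≤ y → y < z → x < z
  ≤-<-trans (inj₁ x<y)  y<z = <-trans x<y y<z
  ≤-<-trans (inj₂ refl) y<z = y<z

  <-≤-trans : ∀ {x y z} → x < y → y ≤ z → x < z
  <-≤-trans x<y (inj₁ y<z)  = <-trans x<y y<z
  <-≤-trans x<y (inj₂ refl) = x<y

  ≤-antisym : ∀ {x y} → x ≤ y → y ≤ x → x ≡ y
  ≤-antisym (inj₂ x≡y) _          = x≡y
  ≤-antisym (inj₁ _)   (inj₂ y≡x) = sym y≡x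
  ≤-antisym (inj₁ x<y) (inj₁ y<x) = contradiction y<x (asym x<y)

  IsLeast : Pred Carrier p → Pred Carrier (ℓ ⊔ p)
  IsLeast P m = m ∈ P × (∀ x → x ∈ P → m ≤ x)

  least : (P : Pred Carrier p) → ∃ P → ∃ (IsLeast P)
  least P (x , Px) = WF.All.wfRec wellFounded _ (λ x → x ∈ P → ∃ (IsLeast P)) step x Px
    where
    step : ∀ x → (∀ {y} → y < x → y ∈ P → ∃ (IsLeast P)) → x ∈ P → ∃ (IsLeast P)
    step x rec Px with em {P = ∃ λ y → y < x × y ∈ P}
    ... | yes (y , y<x , Py) = rec y<x Py
    ... | no none = x , Px , λ y Py → ≮⇒≥ λ y<x → none (y , y<x , Py)

  IsLeast-unique : {P : Pred Carrier p} {Q : Pred Carrier q} {m n : Carrier} →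
    P ≐ Q → IsLeast P m → IsLeast Q n → m ≡ n
  IsLeast-unique (P⊆Q , Q⊆P) (Pm , m≤) (Qn , n≤) =
    ≤-antisym (m≤ _ (Q⊆P Qn)) (n≤ _ (P⊆Q Pm))

-- Bounded sets and closure points in a regular uncountable cardinal.

module RegularCardinalProperties (em : Classical) {ℓ} (Λ : Cardinal ℓ)
  (uncountable : Uncountable Λ) (regular : IsRegularCardinal Λ) where
  open ClassicalLogic em
  open Cardinal Λ
  open CardinalProperties em Λ

  -- If `P` were unbounded, regularity would inject `Λ` into it, and composing with `g` would inject
  -- `Λ` into `S`.
  bounded : (P : Pred Carrier ℓ) (S : Setoid a b) (g : ∃ P → Setoid.Carrier S) →
    (∀ {x y} → Setoid._≈_ S (g x) (g y) → proj₁ x ≡ proj₁ y) →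
    ¬ Injection ∣ Λ ∣ S → ∃ λ β → ∀ x → x ∈ P → x < β
  bounded P S g g-injective ¬Λ↣S with em {P = Unbounded Λ P}
  ... | yes unbounded = contradiction Λ↣S ¬Λ↣S
    where
    module Λ↣P = Injection (proj₂ regular P unbounded)
    Λ↣S : Injection ∣ Λ ∣ S
    Λ↣S = record
      { to        = g ∘ Λ↣P.to
      ; cong      = λ { refl → Setoid.refl S }
      ; injective = Λ↣P.injective ∘ g-injective
      }
  ... | no ¬unbounded =
    let β , none = ¬∀⇒∃¬ ¬unbounded
    in β , λ x Px → ≰⇒> λ β≤x → none (x , Px , β≤x)

  sequence-bounded : (f : ℕ → Carrier) → ∃ λ β → ∀ n → f n < β
  sequence-bounded f =
    let β , <β = bounded (λ x → ∃ λ n → f n ≡ x) (setoid ℕ) (proj₁ ∘ proj₂)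
                   (λ { {_ , _ , refl} {_ , _ , refl} → cong f })
                   (proj₂ uncountable)
    in β , λ n → <β (f n) (n , refl)

  upper : ∀ x y → ∃ λ z → x < z × y < z
  upper x y =
    let z , <z = sequence-bounded λ { 0 → x ; (ℕ.suc _) → y }
    in z , <z 0 , <z 1

  -- Here `i` is the supremum of an ω-sequence that starts at `x₀` and whose each next term exceeds
  -- both the last one and its value under `h`.
  closurePoint : (h : Carrier → Carrier) (x₀ : Carrier) →
    ∃ λ i → x₀ < i × (∀ x → x < i → ∃ λ k → x < k × h k < i)
  closurePoint h x₀ = i , s<i 0 , below
    where
    s : ℕ → Carrier
    s ℕ.zero    = x₀
    s (ℕ.suc n) = proj₁ (upper (s n) (h (s n)))

    sup = least (λ i → ∀ n → s n < i) (sequence-bounded s)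
    i   = proj₁ sup
    s<i = proj₁ (proj₂ sup)

    below : ∀ x → x < i → ∃ λ k → x < k × h k < i
    below x x<i with ¬∀⇒∃¬ (λ s<x → irrefl refl (≤-<-trans (proj₂ (proj₂ sup) x s<x) x<i))
    ... | n , sₙ≮x =
        -- Since `i` is the least bound, some term is at least `x`. Its successor is the witness,
        -- because the term after that exceeds its value under `h`.
        s (ℕ.suc n)
      , ≤-<-trans (≮⇒≥ sₙ≮x) (proj₁ (proj₂ (upper (s n) (h (s n)))))
      , <-trans (proj₂ (proj₂ (upper (s (ℕ.suc n)) (h (s (ℕ.suc n)))))) (s<i (2 ℕ.+ n))

  -- The values of `g` in question are determined by values of `f` below `k`, and `Λ` does not
  -- inject into that initial segment.
  boundedImage : {X : Set ℓ} (f g : X → Carrier) →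
    (∀ {x y} → f x ≡ f y → g x ≡ g y) →
    ∀ k → ∃ λ β → ∀ x → f x < k → g x < β
  boundedImage f g f⇒g k =
    let β , <β = bounded (λ z → ∃ λ x → f x < k × g x ≡ z) ⟪ _< k ⟫ˢ
                   (λ { (_ , x , fx<k , _) → f x , fx<k })
                   (λ { {_ , _ , _ , refl} {_ , _ , _ , refl} → f⇒g })
                   (initial k)
    in β , λ x fx<k → <β (g x) (x , fx<k , refl)

-- The tree orders and their level functions.

module Tree (em : Classical) {ℓ} (Λ Λ⁺ : Cardinal ℓ)
  (succ : IsSuccessorOf Λ Λ⁺) where
  open ClassicalLogic em
  open Cardinal Λ using (_<_; initial) renaming (Carrier to |Λ|)
  open Cardinal Λ⁺ using (_≤_)
    renaming (Carrier to |Λ⁺|; _<_ to _<⁺_; wellFounded to wellFounded⁺)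
  open CardinalProperties em Λ using (IsLeast; least; IsLeast-unique)
  open CardinalProperties em Λ⁺ using (compare; irrefl; ≤-<-trans)
    renaming (<-trans to <⁺-trans)

  module e α = Injection (IsSuccessorOf.least succ α)

  A : |Λ⁺| → |Λ| → Pred |Λ⁺| ℓ
  A α i γ = Σ (γ <⁺ α) λ γ<α → e.to α (γ , γ<α) < i

  -- Equality on the initial segment ignores proofs, so `e.to` takes the same value at any two
  -- proofs of `γ <⁺ α`.
  e<i : ∀ {α i γ} → γ ∈ A α i → (γ<α : γ <⁺ α) → e.to α (γ , γ<α) < i
  e<i {α} {i} (_ , eγ<i) _ = subst (_< i) (e.cong α refl) eγ<i

  record _⊏[_]_ (β : |Λ⁺|) (i : |Λ|) (α : |Λ⁺|) : Set ℓ where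
    constructor mk
    field
      member : β ∈ A α i
      below  : A β i ⊆ A α i
      above  : ∀ {γ} → γ <⁺ β → γ ∈ A α i → γ ∈ A β i

    ⊏⇒< : β <⁺ α
    ⊏⇒< = proj₁ member

  open _⊏[_]_

  ⊏-trans : ∀ {i γ β α} → γ ⊏[ i ] β → β ⊏[ i ] α → γ ⊏[ i ] α
  ⊏-trans γ⊏β β⊏α = mk
    (below β⊏α (member γ⊏β))
    (below β⊏α ∘ below γ⊏β)
    (λ x<γ → above γ⊏β x<γ ∘ above β⊏α (<⁺-trans x<γ (⊏⇒< γ⊏β)))

  -- `A γ i` and `A β i` are both initial segments of `A α i`, hence the shorter is one of the
  -- longer. So the predecessors of `α` form a chain.
  ⊏-tree : ∀ {i γ β α} → γ ⊏[ i ] α → β ⊏[ i ] α → γ <⁺ β → γ ⊏[ i ] β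
  ⊏-tree γ⊏α β⊏α γ<β = mk
    (above β⊏α γ<β (member γ⊏α))
    (λ x∈Aγ → above β⊏α (<⁺-trans (proj₁ x∈Aγ) γ<β) (below γ⊏α x∈Aγ))
    (λ x<γ → above γ⊏α x<γ ∘ below β⊏α)

  _⊑[_]_ : |Λ⁺| → |Λ| → |Λ⁺| → Set ℓ
  β ⊑[ i ] α = β ⊏[ i ] α ⊎ β ≡ α

  ⊑⇒≤ : ∀ {i β α} → β ⊑[ i ] α → β ≤ α
  ⊑⇒≤ (inj₁ β⊏α) = inj₁ (⊏⇒< β⊏α)
  ⊑⇒≤ (inj₂ β≡α) = inj₂ β≡α

  ⊑-trans : ∀ {i γ β α} → γ ⊑[ i ] β → β ⊑[ i ] α → γ ⊑[ i ] α
  ⊑-trans (inj₁ γ⊏β)  (inj₁ β⊏α)  = inj₁ (⊏-trans γ⊏β β⊏α)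
  ⊑-trans (inj₁ γ⊏β)  (inj₂ refl) = inj₁ γ⊏β
  ⊑-trans (inj₂ refl) β⊑α         = β⊑α

  ⊏-⊑-tree : ∀ {i γ β α} → γ ⊑[ i ] α → β ⊑[ i ] α → γ <⁺ β → γ ⊏[ i ] β
  ⊏-⊑-tree (inj₁ γ⊏α)  (inj₁ β⊏α)  γ<β = ⊏-tree γ⊏α β⊏α γ<β
  ⊏-⊑-tree (inj₁ γ⊏α)  (inj₂ refl) γ<β = γ⊏α
  ⊏-⊑-tree (inj₂ refl) β⊑α         γ<β =
    contradiction (≤-<-trans (⊑⇒≤ β⊑α) γ<β) (irrefl refl)

  ⊑-tree : ∀ {i γ β α} → γ ⊑[ i ] α → β ⊑[ i ] α → γ ≤ β → γ ⊑[ i ] β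
  ⊑-tree γ⊑α β⊑α (inj₁ γ<β) = inj₁ (⊏-⊑-tree γ⊑α β⊑α γ<β)
  ⊑-tree γ⊑α β⊑α (inj₂ γ≡β) = inj₂ γ≡β

  module Levels (i : |Λ|) where

    Values : |Λ⁺| → Set ℓ
    Values = WF.WfRec _<⁺_ (λ _ → |Λ|)

    -- Proofs of β <⁺ α need not be unique; recomputing them makes the value
    -- attached to β depend on β alone.
    at : ∀ {α β} → Values α → .(β <⁺ α) → |Λ|
    at IH β<α = IH (recompute em β<α)

    Taken Fresh : ∀ α → Values α → Pred |Λ| ℓ
    Taken α IH δ = ∃ λ β → Σ (β ⊏[ i ] α) λ β⊏α → at IH (⊏⇒< β⊏α) ≡ δ
    Fresh α IH δ = ∀ β (β⊏α : β ⊏[ i ] α) → at IH (⊏⇒< β⊏α) ≢ δ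

    -- The predecessors of `α` lie in `A α i`, which `e.to α` injects into the segment below `i`.
    -- Were every level taken, choosing a predecessor for each would inject `Λ` into that segment.
    fresh : ∀ α (IH : Values α) → ∃ (Fresh α IH)
    fresh α IH = dne λ none →
      let taken : ∀ δ → Taken α IH δ
          taken δ = dne λ ¬taken → none (δ , λ β β⊏α eq → ¬taken (β , β⊏α , eq))
      in initial i record
        { to        = λ δ → let _ , β⊏α , _ = taken δ in _ , e<i (member β⊏α) (⊏⇒< β⊏α)
        ; cong      = λ { refl → refl }
        ; injective = λ {δ} {δ′} eq →
            same (taken δ) (taken δ′) (e.injective α eq)
        }
      where
      same : ∀ {δ δ′} (t : Taken α IH δ) (t′ : Taken α IH δ′) →
        proj₁ t ≡ proj₁ t′ → δ ≡ δ′
      same (_ , _ , refl) (_ , _ , refl) refl = refl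

    leastFresh : ∀ α (IH : Values α) → ∃ (IsLeast (Fresh α IH))
    leastFresh α IH = least (Fresh α IH) (fresh α IH)

    step : ∀ α → Values α → |Λ|
    step α IH = proj₁ (leastFresh α IH)

    -- Unfolding the well-founded recursion requires this. It is why the least fresh value is taken:
    -- an arbitrary choice could vary with `IH`.
    step-ext : ∀ α {IH IH′ : Values α} →
      (∀ {β} β<α → IH {β} β<α ≡ IH′ β<α) → step α IH ≡ step α IH′
    step-ext α {IH} {IH′} IH≡IH′ = IsLeast-unique
      ( (λ new β β⊏α eq → new β β⊏α (trans (IH≡IH′ _) eq))
      , (λ new β β⊏α eq → new β β⊏α (trans (sym (IH≡IH′ _)) eq)))
      (proj₂ (leastFresh α IH)) (proj₂ (leastFresh α IH′))

    abstract
      level : |Λ⁺| → |Λ|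
      level = WF.All.wfRec wellFounded⁺ _ (λ _ → |Λ|) step

      level-fresh : ∀ {β α} → β ⊏[ i ] α → level β ≢ level α
      level-fresh {α = α} β⊏α eq =
        proj₁ (proj₂ (leastFresh α λ {β} _ → level β)) _ β⊏α
          (trans eq (WF.FixPoint.unfold-wfRec wellFounded⁺ (λ _ → |Λ|) step step-ext))

    -- Two distinct points below `α` are comparable in the tree, and the level of the upper one
    -- avoids that of the lower.
    level-injective : ∀ {α} → InjectiveOn (_⊑[ i ] α) level
    level-injective {x = γ} {y = β} γ⊑α β⊑α eq with compare γ β
    ... | tri< γ<β _ _ = contradiction eq (level-fresh (⊏-⊑-tree γ⊑α β⊑α γ<β))
    ... | tri≈ _ γ≡β _ = γ≡β
    ... | tri> _ _ β<γ = contradiction (sym eq) (level-fresh (⊏-⊑-tree β⊑α γ⊑α β<γ))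

  open Levels public using (level; level-injective)

-- The indices that relate two given ordinals form a club.

module Clubs (em : Classical) {ℓ} (Λ Λ⁺ : Cardinal ℓ)
  (succ : IsSuccessorOf Λ Λ⁺)
  (uncountable : Uncountable Λ) (regular : IsRegularCardinal Λ) where
  open Cardinal Λ using (_<_) renaming (Carrier to |Λ|; _≤_ to _≤ᵒ_)
  open Cardinal Λ⁺ using (↓_; _≤_) renaming (Carrier to |Λ⁺|; _<_ to _<⁺_)
  open CardinalProperties em Λ using (<-≤-trans; <-trans)
  open CardinalProperties em Λ⁺ using () renaming (<-trans to <⁺-trans)
  open RegularCardinalProperties em Λ uncountable regular
  open Tree em Λ Λ⁺ succ

  ⊏-closed : ∀ {β α} → β <⁺ α → ∀ δ → IsLimit Λ δ →
    (∀ i → i < δ → ∃ λ j → β ⊏[ j ] α × i ≤ᵒ j × j < δ) → β ⊏[ δ ] α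
  ⊏-closed {β} {α} β<α δ ((i₀ , i₀<δ) , limit) cofinal = mk β∈A
    (λ (γ<β , eγ<δ) →
      let j , β⊏α , eγ<j , j<δ = reflect eγ<δ
          γ<α , e′γ<j = _⊏[_]_.below β⊏α (γ<β , eγ<j)
      in γ<α , <-trans e′γ<j j<δ)
    (λ γ<β (γ<α , eγ<δ) →
      let j , β⊏α , eγ<j , j<δ = reflect eγ<δ
          γ<β′ , e′γ<j = _⊏[_]_.above β⊏α γ<β (γ<α , eγ<j)
      in γ<β′ , <-trans e′γ<j j<δ)
    where
    -- Any single value below the limit `δ` is already below some good `j < δ`, where `β ⊏[ j ] α`
    -- can be applied. The intermediate `y` makes `x < j` strict.
    reflect : ∀ {x} → x < δ → ∃ λ j → β ⊏[ j ] α × x < j × j < δ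
    reflect x<δ =
      let y , x<y , y<δ = limit _ x<δ
          j , β⊏α , y≤j , j<δ = cofinal y y<δ
      in j , β⊏α , <-≤-trans x<y y≤j , j<δ

    β∈A : β ∈ A α δ
    β∈A = let j , β⊏α , _ , j<δ = cofinal i₀ i₀<δ
              β<α , eβ<j = _⊏[_]_.member β⊏α
          in β<α , <-trans eβ<j j<δ

  -- Below `β` both `e` maps are injective, so a bound on either one bounds the other. At an index
  -- closed under both bounds, `A β i` and `A α i` agree below `β`.
  ⊏-unbounded : ∀ {β α} → β <⁺ α → Unbounded Λ (β ⊏[_] α)
  ⊏-unbounded {β} {α} β<α i₀ = i , mk (β<α , <-trans eβ<x₀ x₀<i) below above
                                 , inj₁ (<-trans i₀<x₀ x₀<i)
    where
    eβ eα : ∃ (↓ β) → |Λ|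
    eβ = e.to β
    eα (γ , γ<β) = e.to α (γ , <⁺-trans γ<β β<α)

    fwd = boundedImage eβ eα (λ eq → e.cong α (e.injective β eq))
    bwd = boundedImage eα eβ (λ eq → e.cong β (e.injective α eq))

    join : ∀ k → ∃ λ z → proj₁ (fwd k) < z × proj₁ (bwd k) < z
    join k = upper (proj₁ (fwd k)) (proj₁ (bwd k))

    -- Starting above `e.to α` at `β` puts `β` itself into `A α i`.
    start = upper i₀ (e.to α (β , β<α))
    x₀    = proj₁ start
    i₀<x₀ = proj₁ (proj₂ start)
    eβ<x₀ = proj₂ (proj₂ start)

    closure = closurePoint (proj₁ ∘ join) x₀
    i       = proj₁ closure
    x₀<i    = proj₁ (proj₂ closure)

    below : A β i ⊆ A α i
    below (γ<β , eγ<i) =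
      let k , eγ<k , hk<i = proj₂ (proj₂ closure) _ eγ<i
      in <⁺-trans γ<β β<α
       , <-trans (<-trans (proj₂ (fwd k) (_ , γ<β) eγ<k) (proj₁ (proj₂ (join k)))) hk<i

    above : ∀ {γ} → γ <⁺ β → γ ∈ A α i → γ ∈ A β i
    above γ<β γ∈A =
      let k , eγ<k , hk<i = proj₂ (proj₂ closure) _ (e<i γ∈A (<⁺-trans γ<β β<α))
      in γ<β
       , <-trans (<-trans (proj₂ (bwd k) (_ , γ<β) eγ<k) (proj₂ (proj₂ (join k)))) hk<i

  ⊑-club : ∀ {β α} → β ≤ α → IsClub Λ (β ⊑[_] α)
  ⊑-club (inj₁ β<α) = record
    { unbounded = λ i → let j , β⊏α , i≤j = ⊏-unbounded β<α i in j , inj₁ β⊏α , i≤j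
    ; closed    = λ δ limit cofinal → inj₁ (⊏-closed β<α δ limit λ i i<δ →
                    let j , β⊑α , i≤j , j<δ = cofinal i i<δ
                    -- As `β <⁺ α`, the equality case of `⊑` cannot occur.
                    in j , ⊏-⊑-tree β⊑α (inj₂ refl) β<α , i≤j , j<δ)
    }
  ⊑-club (inj₂ β≡α) = record
    { unbounded = λ i → i , inj₂ β≡α , inj₂ refl
    ; closed    = λ _ _ _ → inj₂ β≡α
    }

-- Regular families indexed by a cardinal.

module RegularFilter (em : Classical) {ℓ d} (μ : Cardinal ℓ) {X : Set ℓ}
  {D : Pred (Pred X ℓ) d} (regular : IsRegularFilter μ D) where
  open ClassicalLogic em
  open Cardinal μ using (Carrier)

  private
    F   = proj₁ regular
    F⊆D = proj₁ (proj₂ regular)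
    module F↔μ = Bijection (proj₂ (proj₂ (proj₂ regular)))

  set : Carrier → Pred X ℓ
  set δ = proj₁ (F↔μ.to⁻ δ)

  set∈D : ∀ δ → set δ ∈ D
  set∈D δ = F⊆D (proj₂ (F↔μ.to⁻ δ))

  -- The members containing `x` have `x` in their intersection, so regularity forbids infinitely
  -- many of them.
  finiteIndices : ∀ x → ∃ λ δs → ∀ δ → x ∈ set δ → δ ∈ˡ δs
  finiteIndices x =
    let As , enumerates = dne λ infinite →
          IsRegularFamily.infinite (proj₁ (proj₂ (proj₂ regular)))
            T proj₁ infinite (x , λ _ → proj₂)
    in map index As , λ δ x∈set →
      let A = set δ , proj₂ (F↔μ.to⁻ δ) , x∈set
      in subst (_∈ˡ map index As) (proj₂ (F↔μ.strictlySurjective δ))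
           (index∈ A (enumerates A))
    where
    T : Pred (Pred X ℓ) ℓ
    T A = A ∈ F × x ∈ A
    index : ∃ T → Carrier
    index (A , A∈F , _) = F↔μ.to (A , A∈F)
    -- The enumeration lists members only up to extensional equality, which `index` respects.
    index∈ : ∀ A {As : List (∃ T)} → Any (λ B → proj₁ A ≐ proj₁ B) As →
      index A ∈ˡ map index As
    index∈ (A , A∈F , _) {(B , B∈F , _) ∷ _} (here A≐B) =
      here (F↔μ.cong {A , A∈F} {B , B∈F} A≐B)
    index∈ A (there A∈As) = there (index∈ A A∈As)

-- Construction of the finite square.

module Square (em : Classical) {ℓ d} (Λ Λ⁺ : Cardinal ℓ)
  (succ : IsSuccessorOf Λ Λ⁺)
  (uncountable : Uncountable Λ) (regular : IsRegularCardinal Λ)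
  (D : Pred (Pred (Cardinal.Carrier Λ) ℓ) d) (doubly : IsDoubly⁺Regular Λ D) where
  open ClassicalLogic em
  open Cardinal Λ using () renaming (Carrier to |Λ|)
  open Cardinal Λ⁺ using (_≤_; ↓₁_) renaming (Carrier to |Λ⁺|)
  open Tree em Λ Λ⁺ succ
  open Clubs em Λ Λ⁺ succ uncountable regular
  open IsDoubly⁺Regular doubly
  module Dᶠ = IsFilterOn isFilter
  module R i = RegularFilter em Λ (regularᵢ i)

  Index : |Λ| → Set ℓ
  Index ξ = ∃ λ i → ξ ∈ u i

  levels : ∀ ξ → Index ξ → List |Λ|
  levels ξ (i , _) = proj₁ (R.finiteIndices i ξ)

  branch : ∀ α ξ (i : Index ξ) → _
  branch α ξ i = finitePreimage (_⊑[ proj₁ i ] α) (level (proj₁ i))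
    (level-injective (proj₁ i)) (levels ξ i)

  -- A `ξ` outside every `u i` gets the empty set. The decision is an argument that does not mention
  -- `α`, so the sets for different `α` share one `i`.
  chain : ∀ α ξ → Dec (Index ξ) → FinSet |Λ⁺|
  chain α ξ (yes i) = proj₁ (branch α ξ i)
  chain α ξ (no _)  = [] , []

  size< : ∀ ξ → Dec (Index ξ) → ℕ
  size< ξ (yes i) = ℕ.suc (length (levels ξ i))
  -- The bound is strict, so even the empty set needs 1.
  size< ξ (no _)  = 1

  chain-bounded : ∀ ξ i? α → ⌊ chain α ξ i? ⌋ ⊆ ↓₁ α
  chain-bounded ξ (yes i) α β∈C =
    ⊑⇒≤ (proj₁ (proj₁ (proj₁ (proj₂ (branch α ξ i))) β∈C))

  -- Transitivity of `⊑` gives one inclusion and the tree property the other; the condition on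
  -- levels is the same for `α` and `β`.
  chain-coherent : ∀ ξ i? α β → β ∈ ⌊ chain α ξ i? ⌋ →
    ⌊ chain β ξ i? ⌋ ≐ ⌊ chain α ξ i? ⌋ ∩ ↓₁ β
  chain-coherent ξ (yes i) α β β∈Cα =
    let Cα⊆ , ⊆Cα = proj₁ (proj₂ (branch α ξ i))
        Cβ⊆ , ⊆Cβ = proj₁ (proj₂ (branch β ξ i))
        β⊑α , _   = Cα⊆ β∈Cα
    in (λ γ∈Cβ → let γ⊑β , γ∈ = Cβ⊆ γ∈Cβ in ⊆Cα (⊑-trans γ⊑β β⊑α , γ∈) , ⊑⇒≤ γ⊑β)
     , (λ (γ∈Cα , γ≤β) → let γ⊑α , γ∈ = Cα⊆ γ∈Cα in ⊆Cβ (⊑-tree γ⊑α β⊑α γ≤β , γ∈))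

  chain-small : ∀ ξ i? α → card (chain α ξ i?) ℕ.< size< ξ i?
  chain-small ξ (yes i) α = ℕ.s≤s (proj₂ (proj₂ (branch α ξ i)))
  chain-small ξ (no _)  α = ℕ.s≤s ℕ.z≤n

  C : |Λ⁺| → |Λ| → FinSet |Λ⁺|
  C α ξ = chain α ξ em

  ∈-chain : ∀ {α β i ξ} i? → β ⊑[ i ] α → ξ ∈ u i → ξ ∈ R.set i (level i β) →
    β ∈ ⌊ chain α ξ i? ⌋
  ∈-chain (no none) β⊑α ξ∈u ξ∈set = contradiction (_ , ξ∈u) none
  ∈-chain {α} {β} {i} {ξ} (yes (j , ξ∈u′)) β⊑α ξ∈u ξ∈set
    -- The index found by the decision is the given one, by disjointness of the `u i`.
    with refl ← dne {P = i ≡ j} (λ i≢j → disjoint i j i≢j (ξ∈u , ξ∈u′)) =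
    proj₂ (proj₁ (proj₂ (branch α ξ (j , ξ∈u′))))
      (β⊑α , proj₂ (R.finiteIndices j ξ) (level j β) ξ∈set)

  large₁ : ∀ {β α} → β ≤ α → (λ ξ → β ∈ ⌊ C α ξ ⌋) ∈ D
  large₁ {β} {α} β≤α = clubs _ ((β ⊑[_] α) , ⊑-club β≤α , λ i β⊑α →
    -- On the club, the member of the regular family indexed by the level of `β` lies inside the set
    -- required.
    IsFilterOn.upward (filterᵢ i) (R.set∈D i (level i β))
      (λ ξ∈set → let ξ∈u = IsFilterOn.subsets (filterᵢ i) (R.set∈D i (level i β)) ξ∈set
                 in ∈-chain em β⊑α ξ∈u ξ∈set , ξ∈u)
      proj₂)

  large : ∀ βs α → (_∈ˡ βs) ⊆ ↓₁ α → (λ ξ → (_∈ˡ βs) ⊆ ⌊ C α ξ ⌋) ∈ D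
  large []       α βs≤α = Dᶠ.upward Dᶠ.whole (λ _ ()) _
  large (β ∷ βs) α βs≤α = Dᶠ.upward
    (Dᶠ.meet (large₁ (βs≤α (here refl))) (large βs α (βs≤α ∘ there)))
    (λ (β∈C , βs⊆C) → λ { (here refl) → β∈C ; (there γ∈βs) → βs⊆C γ∈βs })
    _

  square : □ᶠⁱⁿ Λ Λ⁺ D
  square = record
    { isFilter = isFilter
    ; C        = C
    ; n        = λ ξ → size< ξ em
    ; bounded  = λ ξ → chain-bounded ξ em
    ; large    = λ B → large (proj₁ B)
    ; coherent = λ ξ → chain-coherent ξ em
    ; small    = λ ξ → chain-small ξ em
    }

theorem5 : Classical → ∀ {ℓ d} (Λ Λ⁺ : Cardinal ℓ) → IsSuccessorOf Λ Λ⁺ →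
    Uncountable Λ → IsRegularCardinal Λ →
    (D : Pred (Pred (Cardinal.Carrier Λ) ℓ) d) → IsDoubly⁺Regular Λ D →
    □ᶠⁱⁿ Λ Λ⁺ D
theorem5 em Λ Λ⁺ succ uncountable regular D doubly =
  Square.square em Λ Λ⁺ succ uncountable regular D doubly
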